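{- Let $T=T(r,s)$ be a tree with bipartition classes $R$ and $S$, where $|R|=r\le s=|S|$ and $r=\min(|R|,|S|)\ge 2$. For $m\ge r$ and $n$ sufficiently large compared to $m$, $r$, $s$, $$(r-1)\,n\;\le\;\mathrm{ex}(m,n;T(r,s))\;\le\;(r-1)\,n+O(m).$$
   Context: All graphs are finite, simple and undirected. For a graph $H$ and integers $m\le n$, $\mathrm{ex}(m,n;H)$ is the maximum number of edges in an $H$-free bipartite graph $G=(A,B;E)$ with parts $A,B$ of sizes $|A|=m$ and $|B|=n$. A graph $G$ contains $H$ if there is an injective map $\phi:V(H)\to V(G)$ such that $\phi(u)\phi(v)\in E(G)$ whenever $uv\in E(H)$; $G$ is $H$-free if it does not contain $H$. A tree $T$ is bipartite, and $T=T(r,s)$ indicates that its two bipartition classes $R$ and $S$ have sizes $|R|=r$ and $|S|=s$ with $r\le s$. -}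

module Defs where

open import Level using (0ℓ)
open import Data.Empty using (⊥)
open import Data.Nat using (ℕ; _≤_)
open import Data.Fin using (Fin)
open import Data.Fin.Subset using (Subset; _∈_; ∣_∣)
open import Data.Fin.Subset.Properties using (_∈?_)
open import Data.List using (List; _∷_; _++_; [_])
open import Data.List.Relation.Unary.Linked using (Linked)
open import Data.List.Relation.Unary.Unique.Propositional using (Unique)
open import Data.Product using (Σ-syntax; ∃-syntax; _×_)
open import Data.Sum using (_⊎_; inj₁; inj₂)
open import Data.Vec using (Vec; lookup; map; sum)
open import Function.Definitions using (Injective)
open import Relation.Binary.Core using (Rel)
open import Relation.Binary.Definitions using (Symmetric; Irreflexive; Decidable)
open import Relation.Binary.Construct.Closure.ReflexiveTransitive using (Star)
open import Relation.Binary.PropositionalEquality using (_≡_; refl)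
open import Relation.Nullary using (¬_; no)

-- Finiteness is not a field: every graph quantified over below lives on a
-- vertex set of the form Fin m ⊎ Fin n.
record Graph (V : Set) : Set₁ where
  field
    _~_    : Rel V 0ℓ
    sym    : Symmetric _~_
    irrefl : Irreflexive _≡_ _~_
    _~?_   : Decidable _~_

Contains : {V W : Set} → Graph W → Graph V → Set
Contains {V} {W} G H =
  Σ[ φ ∈ (V → W) ] Injective _≡_ _≡_ φ × (∀ {u v} → u H.~ v → φ u G.~ φ v)
  where
  module G = Graph G
  module H = Graph H

_isFreeOf_ : {V W : Set} → Graph W → Graph V → Set
G isFreeOf H = ¬ Contains G H

module _ {V : Set} (G : Graph V) where
  open Graph G

  -- A cycle u, x, …, w, u: the explicit second vertex x forces at least three
  -- distinct vertices.
  record Cycle : Set where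
    field
      u x w    : V
      vs       : List V
      linked   : Linked _~_ (u ∷ x ∷ vs ++ [ w ])
      distinct : Unique (u ∷ x ∷ vs ++ [ w ])
      closing  : w ~ u

  record IsTree : Set where
    field
      nonempty  : V
      connected : ∀ u v → Star _~_ u v
      acyclic   : ¬ Cycle

-- A bipartite graph (A , B ; E) with A = Fin m and B = Fin n, given by the
-- neighbourhood in B of each vertex of A.
Bipartite : ℕ → ℕ → Set
Bipartite m n = Vec (Subset n) m

module _ {m n : ℕ} (G : Bipartite m n) where

  edgeCount : ℕ
  edgeCount = sum (map ∣_∣ G)

  Adj : Rel (Fin m ⊎ Fin n) 0ℓ
  Adj (inj₁ a) (inj₂ b) = b ∈ lookup G a
  Adj (inj₂ b) (inj₁ a) = b ∈ lookup G a
  Adj (inj₁ _) (inj₁ _) = ⊥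
  Adj (inj₂ _) (inj₂ _) = ⊥

  toGraph : Graph (Fin m ⊎ Fin n)
  toGraph = record
    { _~_ = Adj
    ; sym = λ {u} {v} → adj-sym u v
    ; irrefl = λ {u} → adj-irrefl u
    ; _~?_ = adj?
    }
    where
    adj-sym : ∀ u v → Adj u v → Adj v u
    adj-sym (inj₁ _) (inj₂ _) e = e
    adj-sym (inj₂ _) (inj₁ _) e = e

    adj-irrefl : ∀ u {v} → u ≡ v → ¬ Adj u v
    adj-irrefl (inj₁ _) refl ()
    adj-irrefl (inj₂ _) refl ()

    adj? : Decidable Adj
    adj? (inj₁ a) (inj₂ b) = b ∈? lookup G a
    adj? (inj₂ b) (inj₁ a) = b ∈? lookup G a
    adj? (inj₁ _) (inj₁ _) = no λ ()
    adj? (inj₂ _) (inj₂ _) = no λ ()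

-- IsEx m n H k says ex(m,n;H) = k.  It is a relation because the maximum does
-- not exist when no bipartite graph with these part sizes is H-free.
IsEx : (m n : ℕ) {V : Set} → Graph V → ℕ → Set
IsEx m n H k =
  (∃[ G ] toGraph {m} {n} G isFreeOf H × edgeCount G ≡ k) ×
  ((G : Bipartite m n) → toGraph G isFreeOf H → edgeCount G ≤ k)

{-# OPTIONS --safe #-}
-- One can take C = s − 1, already for all n ≥ m.
--
-- Lower bound: make r − 1 vertices of A adjacent to all of B and leave the rest
-- of A isolated.  An embedding of the connected T maps R or S entirely into A;
-- both have at least r vertices, none of them isolated.
--
-- Upper bound: if G has more than (r − 1) n + (s − 1) m edges, keep deleting
-- vertices of A of degree at most s − 1 and vertices of B of degree at most
-- r − 1.  The inequality between the edge count and the part sizes survives each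
-- deletion, so this stops at a nonempty graph with degrees at least s on A and
-- at least r on B, into which T embeds greedily, one vertex at a time.
module Submission where

open import Defs
open import Data.Nat.Properties
open import Algebra.Properties.CommutativeMonoid.Sum +-0-commutativeMonoid using (sum; sum-remove; ∑-comm)
open import Algebra.Properties.CommutativeSemigroup +-commutativeSemigroup using (x∙yz≈y∙xz)
open import Data.Bool using (Bool; true; false; not)
open import Data.Fin using (Fin; zero; suc; _↑ˡ_; punchIn; punchOut; splitAt; join)
open import Data.Fin.Properties using (any?; injective⇒≤; punchIn-injective; punchOut-injective; splitAt-join) renaming (_≟_ to _≟ᶠ_; suc-injective to sucᶠ-injective)
open import Data.Fin.Subset using (Subset; _∈_; ∣_∣; ⊤; ⊥)
open import Data.Fin.Subset.Properties using (anySubset?; ∣⊤∣≡n; ∣⊥∣≡0; ∉⊥)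
open import Data.List as List using (List; []; _∷_; _++_; [_]; allFin)
import Data.List.Membership.DecPropositional as DecMembership
open import Data.List.Membership.Propositional.Properties using (∈-++⁺ˡ; ∈-++⁺ʳ; ∈-map⁺; ∈-allFin)
open import Data.List.Membership.Propositional using () renaming (_∈_ to _∈ˡ_)
open import Data.List.Relation.Binary.Subset.Propositional using () renaming (_⊆_ to _⊆ˡ_)
open import Data.List.Relation.Unary.All as All using (All; []; _∷_)
import Data.List.Relation.Unary.All.Properties as All
import Data.List.Relation.Unary.AllPairs.Properties as AllPairs
open import Data.List.Relation.Unary.AllPairs using ([]; _∷_)
open import Data.List.Relation.Unary.Any using (here; there)
open import Data.List.Relation.Unary.Linked using (Linked; [-]; _∷_)
open import Data.List.Relation.Unary.Unique.Propositional using (Unique)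
open import Data.Nat using (ℕ; zero; suc; _≤_; _<_; _+_; _*_; _∸_; z≤n; s≤s; _≤?_)
open import Data.Product using (Σ-syntax; ∃; ∃-syntax; _×_; _,_; proj₁; proj₂)
open import Data.Sum as Sum using (_⊎_; inj₁; inj₂)
open import Data.Sum.Properties using (inj₁-injective; inj₂-injective; ≡-dec)
open import Data.Vec as Vec using (Vec; []; _∷_; lookup; tabulate; replicate)
open import Data.Vec.Properties using (lookup∘tabulate; lookup-replicate; lookup⇒[]=)
open import Function using (_∘_; id; case_of_)
open import Function.Definitions using (Injective)
open import Relation.Binary.Construct.Closure.ReflexiveTransitive using (Star; ε; _◅_)
open import Relation.Binary.Definitions using (DecidableEquality)
open import Relation.Binary.PropositionalEquality hiding ([_])
open import Relation.Nullary using (¬_; Dec; yes; no; contradiction)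
open import Relation.Nullary.Decidable using (map′; ¬?; decidable-stable; _×-dec_; _⊎-dec_; _→-dec_)
open import Relation.Unary using (Decidable)

-- Searchable types

-- `IsEx` asks for an attained maximum. Constructively it is found by exhaustive search, so
-- existence must be decidable over the types of graphs and of vertex maps.
Searchable : Set → Set₁
Searchable A = {P : A → Set} → Decidable P → Dec (∃ P)

searchVec : ∀ {A} → Searchable A → ∀ n → Searchable (Vec A n)
searchVec search zero P? = map′ ([] ,_) (λ { ([] , p) → p }) (P? [])
searchVec search (suc n) P? =
  map′ (λ { (x , xs , p) → x ∷ xs , p }) (λ { (x ∷ xs , p) → x , xs , p })
    (search λ x → searchVec search n (P? ∘ (x ∷_)))

searchSum : ∀ {m n} → Searchable (Fin m ⊎ Fin n)
searchSum P? =
  map′ (λ { (inj₁ (i , p)) → inj₁ i , p ; (inj₂ (j , p)) → inj₂ j , p })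
       (λ { (inj₁ i , p) → inj₁ (i , p) ; (inj₂ j , p) → inj₂ (j , p) })
       (any? (P? ∘ inj₁) ⊎-dec any? (P? ∘ inj₂))

searchAll : ∀ {A} → Searchable A → {P : A → Set} → Decidable P → Dec (∀ x → P x)
searchAll search P? =
  map′ (λ none x → decidable-stable (P? x) (λ ¬p → none (x , ¬p)))
       (λ all (x , ¬p) → ¬p (all x))
       (¬? (search (¬? ∘ P?)))

-- Descent on the a priori bound `k`: either some element attains it and is maximal, or the bound
-- drops by one. At bound zero any witness is maximal.
searchMax : ∀ {A} → Searchable A → {P : A → Set} → Decidable P → (f : A → ℕ) →
  ∃ P → (k : ℕ) → (∀ x → P x → f x ≤ k) →
  ∃[ x ] P x × (∀ y → P y → f y ≤ f x)
searchMax search P? f (x , px) zero f≤k =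
  x , px , λ y py → ≤-trans (f≤k y py) z≤n
searchMax search P? f witness (suc k) f≤k
  with search (λ x → P? x ×-dec (f x ≟ suc k))
... | yes (x , px , fx≡1+k) =
  x , px , λ y py → subst (f y ≤_) (sym fx≡1+k) (f≤k y py)
... | no none = searchMax search P? f witness k
  λ x px → ≤-pred (≤∧≢⇒< (f≤k x px) (λ eq → none (x , px , eq)))

-- Deciding containment

module _ {m n r s : ℕ} (G : Graph (Fin m ⊎ Fin n)) (H : Graph (Fin r ⊎ Fin s)) where
  private
    module G = Graph G
    module H = Graph H

    IsEmbedding : (Fin r ⊎ Fin s → Fin m ⊎ Fin n) → Set
    IsEmbedding φ = ∀ u v → (φ u ≡ φ v → u ≡ v) × (u H.~ v → φ u G.~ φ v)

    isEmbedding? : Decidable IsEmbedding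
    isEmbedding? φ = searchAll searchSum λ u → searchAll searchSum λ v →
      (≡-dec _≟ᶠ_ _≟ᶠ_ (φ u) (φ v) →-dec ≡-dec _≟ᶠ_ _≟ᶠ_ u v)
      ×-dec (u H.~? v →-dec φ u G.~? φ v)

    -- Maps are searched through their vectors of values. Without function extensionality a map is
    -- recovered from its vector only pointwise, which suffices because `IsEmbedding` looks at
    -- values alone.
    decode : Vec (Fin m ⊎ Fin n) (r + s) → Fin r ⊎ Fin s → Fin m ⊎ Fin n
    decode xs = lookup xs ∘ join r s

    decode-surjective : ∀ φ u → decode (tabulate (φ ∘ splitAt r)) u ≡ φ u
    decode-surjective φ u =
      trans (lookup∘tabulate _ (join r s u)) (cong φ (splitAt-join r s u))

    isEmbedding-resp-≗ : ∀ {φ ψ} → φ ≗ ψ → IsEmbedding ψ → IsEmbedding φ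
    isEmbedding-resp-≗ φ≗ψ emb u v rewrite φ≗ψ u | φ≗ψ v = emb u v

  contains? : Dec (Contains G H)
  contains? = map′
    (λ (xs , emb) → decode xs , (λ {u} {v} → proj₁ (emb u v)) , λ {u} {v} → proj₂ (emb u v))
    (λ (φ , inj , hom) → tabulate (φ ∘ splitAt r) ,
      isEmbedding-resp-≗ (decode-surjective φ) (λ u v → inj , hom))
    (searchVec searchSum (r + s) (isEmbedding? ∘ decode))

-- Greedy embedding of a tree

module _ {V W : Set} (_≟ⱽ_ : DecidableEquality V)
  {H : Graph V} (tree : IsTree H) (G : Graph W) where
  private
    module H = Graph H
    module G = Graph G

  open IsTree tree
  open DecMembership _≟ⱽ_ using () renaming (_∈?_ to _∈ˡ?_)

  private
    _[_↦_] : (V → W) → V → W → V → W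
    (φ [ v ↦ w ]) u with u ≟ⱽ v
    ... | yes _ = w
    ... | no  _ = φ u

    updated : ∀ φ v w → (φ [ v ↦ w ]) v ≡ w
    updated φ v w with v ≟ⱽ v
    ... | yes _ = refl
    ... | no v≢v = contradiction refl v≢v

    unchanged : ∀ φ v w {u} → u ≢ v → (φ [ v ↦ w ]) u ≡ φ u
    unchanged φ v w {u} u≢v with u ≟ⱽ v
    ... | yes u≡v = contradiction u≡v u≢v
    ... | no _ = refl

    -- The vertex list has the same shape as in `Cycle`, so one more vertex in front turns a path
    -- into a cycle. A path has two distinct ends; the trivial case is the equality alternative in
    -- `joined`.
    PathIn : List V → V → V → Set
    PathIn us u w = ∃[ vs ] Linked H._~_ (u ∷ vs ++ [ w ])
      × Unique (u ∷ vs ++ [ w ]) × All (_∈ˡ us) (u ∷ vs ++ [ w ])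

    PathIn-⊆ : ∀ {us us′ u w} → us ⊆ˡ us′ → PathIn us u w → PathIn us′ u w
    PathIn-⊆ us⊆us′ (vs , linked , unique , inside) =
      vs , linked , unique , All.map us⊆us′ inside

    linked-∷ʳ : ∀ xs {p v} → Linked H._~_ (xs ++ [ p ]) → p H.~ v →
      Linked H._~_ ((xs ++ [ p ]) ++ [ v ])
    linked-∷ʳ [] [-] p~v = p~v ∷ [-]
    linked-∷ʳ (x ∷ []) (x~p ∷ linked) p~v = x~p ∷ linked-∷ʳ [] linked p~v
    linked-∷ʳ (x ∷ y ∷ xs) (x~y ∷ linked) p~v = x~y ∷ linked-∷ʳ (y ∷ xs) linked p~v

    distinct-from : ∀ {us v} {xs : List V} → ¬ v ∈ˡ us → All (_∈ˡ us) xs → All (v ≢_) xs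
    distinct-from v∉us = All.map λ { x∈us refl → v∉us x∈us }

    closeCycle : ∀ {us u w v} → ¬ v ∈ˡ us → PathIn us u w →
      v H.~ u → v H.~ w → Cycle H
    closeCycle {u = u} {w} {v} v∉us (vs , linked , unique , inside) v~u v~w = record
      { u = v ; x = u ; w = w ; vs = vs
      ; linked = v~u ∷ linked
      ; distinct = distinct-from v∉us inside ∷ unique
      ; closing = H.sym v~w
      }

    prependPath : ∀ {us v p u} → ¬ v ∈ˡ us → v H.~ p → PathIn us p u → PathIn (v ∷ us) v u
    prependPath {p = p} v∉us v~p (vs , linked , unique , inside) =
      p ∷ vs , v~p ∷ linked , distinct-from v∉us inside ∷ unique ,
      here refl ∷ All.map there inside

    appendPath : ∀ {us v p u} → ¬ v ∈ˡ us → p H.~ v → PathIn us u p → PathIn (v ∷ us) u v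
    appendPath {p = p} {u} v∉us p~v (vs , linked , unique , inside) =
      vs ++ [ p ] , linked-∷ʳ (u ∷ vs) linked p~v ,
      AllPairs.++⁺ unique ([] ∷ [])
        (All.map (λ v≢x → v≢x ∘ sym ∷ []) (distinct-from v∉us inside)) ,
      All.++⁺ (All.map there inside) (here refl ∷ [])

    edgePath : ∀ {us u v} → u ∈ˡ us → v ∈ˡ us → u H.~ v → PathIn us u v
    edgePath u∈us v∈us u~v = [] , u~v ∷ [-] ,
      ((λ u≡v → H.irrefl u≡v u~v) ∷ []) ∷ [] ∷ [] , u∈us ∷ v∈us ∷ []

  -- Since `φ` is total, vertices not yet placed carry provisional values, and `w` has to avoid
  -- these as well. The degree bounds can afford this: they count every other vertex in the class of
  -- `v`, placed or not.
  Extendable : (V → W → Set) → Set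
  Extendable Allowed = (φ : V → W) → (∀ u → Allowed u (φ u)) → ∀ {p v} → p H.~ v →
    ∃[ w ] Allowed v w × φ p G.~ w × (∀ u → u ≢ v → φ u ≢ w)

  module _ (Allowed : V → W → Set) (fresh : Extendable Allowed) where
    private
      -- In a partial embedding only the values of φ on the placed vertices
      -- matter.  For neighbours to stay unique, the placed vertices must span a
      -- connected subgraph, whence the field joined.
      record Partial (us : List V) : Set where
        field
          φ        : V → W
          allowed  : ∀ u → Allowed u (φ u)
          inj      : ∀ {u w} → u ∈ˡ us → w ∈ˡ us → φ u ≡ φ w → u ≡ w
          hom      : ∀ {u w} → u ∈ˡ us → w ∈ˡ us → u H.~ w → φ u G.~ φ w
          joined   : ∀ {u w} → u ∈ˡ us → w ∈ˡ us → u ≡ w ⊎ PathIn us u w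

      place : ∀ {us p v} → Partial us → p ∈ˡ us → ¬ v ∈ˡ us → p H.~ v → Partial (v ∷ us)
      place {us} {p} {v} E p∈us v∉us p~v = record
        { φ = ψ ; allowed = ψ-allowed ; inj = ψ-inj ; hom = ψ-hom ; joined = ψ-joined }
        where
        open Partial E

        w : W
        w = proj₁ (fresh φ allowed p~v)

        w-allowed : Allowed v w
        w-allowed = proj₁ (proj₂ (fresh φ allowed p~v))

        φp~w : φ p G.~ w
        φp~w = proj₁ (proj₂ (proj₂ (fresh φ allowed p~v)))

        w-fresh : ∀ u → u ≢ v → φ u ≢ w
        w-fresh = proj₂ (proj₂ (proj₂ (fresh φ allowed p~v)))

        ψ : V → W
        ψ = φ [ v ↦ w ]

        old≢v : ∀ {u} → u ∈ˡ us → u ≢ v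
        old≢v u∈us refl = v∉us u∈us

        ψ-old : ∀ {u} → u ∈ˡ us → ψ u ≡ φ u
        ψ-old u∈us = unchanged φ v w (old≢v u∈us)

        ψ-new : ψ v ≡ w
        ψ-new = updated φ v w

        ψ-allowed : ∀ u → Allowed u (ψ u)
        ψ-allowed u with u ≟ⱽ v
        ... | yes refl = w-allowed
        ... | no _ = allowed u

        ψold≢ψnew : ∀ {u} → u ∈ˡ us → ψ u ≢ ψ v
        ψold≢ψnew u∈us eq =
          w-fresh _ (old≢v u∈us) (trans (sym (ψ-old u∈us)) (trans eq ψ-new))

        ψ-inj : ∀ {u x} → u ∈ˡ v ∷ us → x ∈ˡ v ∷ us → ψ u ≡ ψ x → u ≡ x
        ψ-inj (here refl) (here refl) _ = refl
        ψ-inj (here refl) (there x∈us) eq = contradiction (sym eq) (ψold≢ψnew x∈us)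
        ψ-inj (there u∈us) (here refl) eq = contradiction eq (ψold≢ψnew u∈us)
        ψ-inj (there u∈us) (there x∈us) eq =
          inj u∈us x∈us (trans (sym (ψ-old u∈us)) (trans eq (ψ-old x∈us)))

        -- A second placed neighbour of `v` would be joined to `p` by a path through placed
        -- vertices, and `v` would close it to a cycle. Hence placing `v` creates only one edge to
        -- respect, the one to `p`.
        parent-unique : ∀ {u} → u ∈ˡ us → u H.~ v → u ≡ p
        parent-unique u∈us u~v with joined u∈us p∈us
        ... | inj₁ u≡p = u≡p
        ... | inj₂ path =
          contradiction (closeCycle v∉us path (H.sym u~v) (H.sym p~v)) acyclic

        ψ-hom-new : ∀ {u} → u ∈ˡ us → u H.~ v → ψ u G.~ ψ v
        ψ-hom-new u∈us u~v with refl ← parent-unique u∈us u~v =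
          subst₂ G._~_ (sym (ψ-old u∈us)) (sym ψ-new) φp~w

        ψ-hom : ∀ {u x} → u ∈ˡ v ∷ us → x ∈ˡ v ∷ us → u H.~ x → ψ u G.~ ψ x
        ψ-hom (here refl) (here refl) v~v = contradiction v~v (H.irrefl refl)
        ψ-hom (here refl) (there x∈us) v~x = G.sym (ψ-hom-new x∈us (H.sym v~x))
        ψ-hom (there u∈us) (here refl) u~v = ψ-hom-new u∈us u~v
        ψ-hom (there u∈us) (there x∈us) u~x =
          subst₂ G._~_ (sym (ψ-old u∈us)) (sym (ψ-old x∈us)) (hom u∈us x∈us u~x)

        ψ-joined : ∀ {u x} → u ∈ˡ v ∷ us → x ∈ˡ v ∷ us → u ≡ x ⊎ PathIn (v ∷ us) u x
        ψ-joined (here refl) (here refl) = inj₁ refl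
        ψ-joined (here refl) (there x∈us) with joined p∈us x∈us
        ... | inj₁ refl = inj₂ (edgePath (here refl) (there x∈us) (H.sym p~v))
        ... | inj₂ path = inj₂ (prependPath v∉us (H.sym p~v) path)
        ψ-joined (there u∈us) (here refl) with joined u∈us p∈us
        ... | inj₁ refl = inj₂ (edgePath (there u∈us) (here refl) p~v)
        ... | inj₂ path = inj₂ (appendPath v∉us p~v path)
        ψ-joined (there u∈us) (there x∈us) =
          Sum.map₂ (PathIn-⊆ there) (joined u∈us x∈us)

      -- Follow the walk from a placed vertex: each unplaced vertex met is placed next to its
      -- predecessor, and vertices already placed are passed over.
      grow : ∀ {us x v} → Partial us → x ∈ˡ us → Star H._~_ x v →
        ∃[ us′ ] Partial us′ × us ⊆ˡ us′ × v ∈ˡ us′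
      grow E x∈us ε = _ , E , id , x∈us
      grow {us} E x∈us (_◅_ {j = y} x~y path) with y ∈ˡ? us
      ... | yes y∈us = grow E y∈us path
      ... | no y∉us =
        let us′ , E′ , sub , v∈us′ = grow (place E x∈us y∉us x~y) (here refl) path
        in us′ , E′ , sub ∘ there , v∈us′

      root : (∃[ φ ] ∀ u → Allowed u (φ u)) → Partial [ nonempty ]
      root (φ , allowed) = record
        { φ = φ ; allowed = allowed
        ; inj = λ { (here refl) (here refl) _ → refl }
        ; hom = λ { (here refl) (here refl) u~u → contradiction u~u (H.irrefl refl) }
        ; joined = λ { (here refl) (here refl) → inj₁ refl }
        }

      growAll : ∀ {us} (vs : List V) → Partial us → nonempty ∈ˡ us →
        ∃[ us′ ] Partial us′ × us ⊆ˡ us′ × (∀ {v} → v ∈ˡ vs → v ∈ˡ us′)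
      growAll [] E _ = _ , E , id , λ ()
      growAll (v ∷ vs) E root∈us =
        let us₁ , E₁ , sub₁ , v∈us₁ = grow E root∈us (connected nonempty v)
            us₂ , E₂ , sub₂ , vs⊆us₂ = growAll vs E₁ (sub₁ root∈us)
        in us₂ , E₂ , sub₂ ∘ sub₁ , λ { (here refl) → sub₂ v∈us₁ ; (there v∈vs) → vs⊆us₂ v∈vs }

    treeEmbedding : (vs : List V) → (∀ v → v ∈ˡ vs) →
      (∃[ φ ] ∀ u → Allowed u (φ u)) → Contains G H
    treeEmbedding vs all∈vs start with growAll vs (root start) (here refl)
    ... | us , E , _ , vs⊆us =
      φ , inj (placed _) (placed _) , hom (placed _) (placed _)
      where
      open Partial E
      placed : ∀ v → v ∈ˡ us
      placed v = vs⊆us (all∈vs v)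

-- Degrees and counting

weight : Bool → ℕ
weight true = 1
weight false = 0

ones : ∀ {n} → (Fin n → Bool) → ℕ
ones v = sum (weight ∘ v)

ones-enumerate : ∀ {n} (v : Fin n → Bool) {k} → k ≤ ones v →
  ∃[ e ] Injective _≡_ _≡_ e × (∀ (t : Fin k) → v (e t) ≡ true)
ones-enumerate {n} v {zero} _ = (λ ()) , (λ { {()} }) , λ ()
ones-enumerate {suc n} v {suc k} k≤ with v zero in v₀
... | true = cons (ones-enumerate (v ∘ suc) (≤-pred k≤))
  where
  cons : (∃[ e ] Injective _≡_ _≡_ e × (∀ (t : Fin k) → v (suc (e t)) ≡ true)) →
    ∃[ e ] Injective _≡_ _≡_ e × (∀ (t : Fin (suc k)) → v (e t) ≡ true)
  cons (e , inj , hit) = e′ , e′-inj , λ { zero → v₀ ; (suc t) → hit t }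
    where
    e′ : Fin (suc k) → Fin (suc n)
    e′ zero = zero
    e′ (suc t) = suc (e t)
    e′-inj : Injective _≡_ _≡_ e′
    e′-inj {zero} {zero} _ = refl
    e′-inj {suc _} {suc _} eq = cong suc (inj (sucᶠ-injective eq))
... | false with e , inj , hit ← ones-enumerate (v ∘ suc) k≤ =
  suc ∘ e , inj ∘ sucᶠ-injective , hit

-- k distinct candidates cannot all be among the k − 1 values of h away from v.
freshCandidate : ∀ {W : Set} → DecidableEquality W → ∀ {k} (e : Fin k → W) →
  Injective _≡_ _≡_ e → (h : Fin k → W) (v : Fin k) →
  ∃[ t ] (∀ j → j ≢ v → h j ≢ e t)
freshCandidate _≟ᵂ_ {suc k} e e-inj h v
  with any? (λ t → ¬? (any? λ j → ¬? (j ≟ᶠ v) ×-dec (h j ≟ᵂ e t)))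
... | yes (t , free) = t , λ j j≢v eq → free (j , j≢v , eq)
... | no none = contradiction (injective⇒≤ out-injective) 1+n≰n
  where
  hit : ∀ t → ∃[ j ] (j ≢ v × h j ≡ e t)
  hit t = decidable-stable (any? λ j → ¬? (j ≟ᶠ v) ×-dec (h j ≟ᵂ e t)) (λ free → none (t , free))

  v≢ : ∀ t → v ≢ proj₁ (hit t)
  v≢ t = proj₁ (proj₂ (hit t)) ∘ sym

  -- Every candidate is hit at an index other than `v`. Removing `v` from the indices would send
  -- `k + 1` distinct candidates injectively into `k` places.
  out : Fin (suc k) → Fin k
  out t = punchOut (v≢ t)

  out-injective : Injective _≡_ _≡_ out
  out-injective {t} {u} eq = e-inj (trans (sym (proj₂ (proj₂ (hit t))))
    (trans (cong h (punchOut-injective (v≢ t) (v≢ u) eq)) (proj₂ (proj₂ (hit u)))))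

total : ∀ {m n} → (Fin m → Fin n → Bool) → ℕ
total M = sum (λ i → ones (M i))

total-comm : ∀ {m n} (M : Fin m → Fin n → Bool) → total M ≡ total (λ j i → M i j)
total-comm M = ∑-comm (λ i j → weight (M i j))

total-removeRow : ∀ {m n} (M : Fin (suc m) → Fin n → Bool) i →
  total M ≡ ones (M i) + total (M ∘ punchIn i)
total-removeRow M i = sum-remove {i = i} (λ i → ones (M i))

total-removeColumn : ∀ {m n} (M : Fin m → Fin (suc n) → Bool) j →
  total M ≡ ones (λ i → M i j) + total (λ i → M i ∘ punchIn j)
total-removeColumn M j = begin
  total M                                                   ≡⟨ total-comm M ⟩
  total (λ j i → M i j)                                     ≡⟨ total-removeRow (λ j i → M i j) j ⟩
  ones (λ i → M i j) + total (λ j′ i → M i (punchIn j j′))  ≡⟨ cong (ones (λ i → M i j) +_) (total-comm λ j′ i → M i (punchIn j j′)) ⟩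
  ones (λ i → M i j) + total (λ i → M i ∘ punchIn j)        ∎
  where open ≡-Reasoning

-- Once the two sums are exchanged, the outer one is empty and computes to zero.
total-noColumns : ∀ {m} (M : Fin m → Fin 0 → Bool) → total M ≡ 0
total-noColumns M = total-comm M

∣∣≡ones : ∀ {n} (p : Subset n) → ∣ p ∣ ≡ ones (lookup p)
∣∣≡ones [] = refl
∣∣≡ones (true ∷ p) = cong suc (∣∣≡ones p)
∣∣≡ones (false ∷ p) = ∣∣≡ones p

edgeCount≡total : ∀ {m n} (G : Bipartite m n) →
  edgeCount G ≡ total (λ a b → lookup (lookup G a) b)
edgeCount≡total [] = refl
edgeCount≡total (p ∷ G) = cong₂ _+_ (∣∣≡ones p) (edgeCount≡total G)

-- Upper bound

-- From here on the parts of T have r + 1 and s + 1 vertices.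

module _ {m n r s : ℕ} (G : Bipartite m n)
  (T : Bipartite (suc r) (suc s)) (tree : IsTree (toGraph T)) where
  private
    -- The vertices surviving the deletions are recorded by maps `α` and `β` into the original
    -- parts, so that a tree found among them already lies in `G`.
    matrix : ∀ {m′ n′} → (Fin m′ → Fin m) → (Fin n′ → Fin n) → Fin m′ → Fin n′ → Bool
    matrix α β i j = lookup (lookup G (α i)) (β j)

  module _ {m′ n′ : ℕ} (α : Fin (suc m′) → Fin m) (β : Fin (suc n′) → Fin n)
    (α-inj : Injective _≡_ _≡_ α) (β-inj : Injective _≡_ _≡_ β)
    (rowDegree : ∀ i → s < ones (matrix α β i))
    (columnDegree : ∀ j → r < ones (λ i → matrix α β i j)) where
    private
      Allowed : Fin (suc r) ⊎ Fin (suc s) → Fin m ⊎ Fin n → Set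
      Allowed (inj₁ _) w = ∃[ i ] w ≡ inj₁ (α i)
      Allowed (inj₂ _) w = ∃[ j ] w ≡ inj₂ (β j)

      -- The image of `p` has one more surviving neighbour than there are other vertices in the
      -- class of `v`, so some neighbour is free. The class of `p` cannot collide with it, as
      -- `Allowed` keeps the classes on opposite sides.
      fresh : ∀ φ → (∀ u → Allowed u (φ u)) → ∀ p v → Adj T p v →
        ∃[ w ] Allowed v w × Adj G (φ p) w × (∀ u → u ≢ v → φ u ≢ w)
      fresh φ allowed (inj₁ a) (inj₂ b) _
        with i , φa≡αi ← allowed (inj₁ a)
        with e , e-inj , hit ← ones-enumerate (matrix α β i) (rowDegree i)
        with t , free ← freshCandidate (≡-dec _≟ᶠ_ _≟ᶠ_) (inj₂ ∘ β ∘ e)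
               (e-inj ∘ β-inj ∘ inj₂-injective) (φ ∘ inj₂) b =
        inj₂ (β (e t)) , (e t , refl) ,
        subst (λ x → Adj G x (inj₂ (β (e t)))) (sym φa≡αi) (lookup⇒[]= _ _ (hit t)) ,
        λ { (inj₁ c) _ eq → case trans (sym eq) (proj₂ (allowed (inj₁ c))) of λ ()
          ; (inj₂ c) c≢b → free c (c≢b ∘ cong inj₂) }
      fresh φ allowed (inj₂ b) (inj₁ a) _
        with j , φb≡βj ← allowed (inj₂ b)
        with e , e-inj , hit ← ones-enumerate (λ i → matrix α β i j) (columnDegree j)
        with t , free ← freshCandidate (≡-dec _≟ᶠ_ _≟ᶠ_) (inj₁ ∘ α ∘ e)
               (e-inj ∘ α-inj ∘ inj₁-injective) (φ ∘ inj₁) a =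
        inj₁ (α (e t)) , (e t , refl) ,
        subst (λ x → Adj G x (inj₁ (α (e t)))) (sym φb≡βj) (lookup⇒[]= _ _ (hit t)) ,
        λ { (inj₁ c) c≢a → free c (c≢a ∘ cong inj₁)
          ; (inj₂ c) _ eq → case trans (sym eq) (proj₂ (allowed (inj₂ c))) of λ () }

      vertices : List (Fin (suc r) ⊎ Fin (suc s))
      vertices = List.map inj₁ (allFin _) ++ List.map inj₂ (allFin _)

      ∈-vertices : ∀ v → v ∈ˡ vertices
      ∈-vertices (inj₁ a) = ∈-++⁺ˡ (∈-map⁺ inj₁ (∈-allFin a))
      ∈-vertices (inj₂ b) = ∈-++⁺ʳ (List.map inj₁ (allFin _)) (∈-map⁺ inj₂ (∈-allFin b))

    largeDegrees⇒contains : Contains (toGraph G) (toGraph T)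
    largeDegrees⇒contains =
      treeEmbedding (≡-dec _≟ᶠ_ _≟ᶠ_) tree (toGraph G) Allowed
        (λ φ allowed {p} {v} → fresh φ allowed p v) vertices ∈-vertices
        -- The provisional values may coincide: they only have to be allowed, and injectivity is
        -- demanded on placed vertices alone.
        (Sum.map (λ _ → α zero) (λ _ → β zero) ,
         λ { (inj₁ _) → zero , refl ; (inj₂ _) → zero , refl })

  private
    -- Deleting a row costs at most `s` edges and lowers the threshold by exactly `s`; likewise for
    -- a column with `r`. An empty part would leave no edges, contradicting the strict inequality,
    -- so the deletions stop while both parts are nonempty.
    dense⇒contains′ : ∀ m′ n′ (α : Fin m′ → Fin m) (β : Fin n′ → Fin n) →
      Injective _≡_ _≡_ α → Injective _≡_ _≡_ β →
      r * n′ + s * m′ < total (matrix α β) → Contains (toGraph G) (toGraph T)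
    dense⇒contains′ zero n′ α β α-inj β-inj dense = contradiction dense n≮0
    dense⇒contains′ (suc m′) zero α β α-inj β-inj dense =
      contradiction (subst (r * 0 + s * suc m′ <_) (total-noColumns (matrix α β)) dense) n≮0
    dense⇒contains′ (suc m′) (suc n′) α β α-inj β-inj dense
      with any? (λ i → ones (matrix α β i) ≤? s)
         | any? (λ j → ones (λ i → matrix α β i j) ≤? r)
    ... | yes (i , deg≤s) | _ =
      dense⇒contains′ m′ (suc n′) (α ∘ punchIn i) β (punchIn-injective i _ _ ∘ α-inj) β-inj
        (+-cancelˡ-< s _ _ (begin-strict
          s + (r * suc n′ + s * m′)  ≡⟨ x∙yz≈y∙xz s (r * suc n′) (s * m′) ⟩
          r * suc n′ + (s + s * m′)  ≡⟨ cong (r * suc n′ +_) (*-suc s m′) ⟨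
          r * suc n′ + s * suc m′    <⟨ dense ⟩
          total (matrix α β)         ≡⟨ total-removeRow (matrix α β) i ⟩
          ones (matrix α β i) + total (matrix (α ∘ punchIn i) β)  ≤⟨ +-monoˡ-≤ _ deg≤s ⟩
          s + total (matrix (α ∘ punchIn i) β)                    ∎))
      where open ≤-Reasoning
    ... | no _ | yes (j , deg≤r) =
      dense⇒contains′ (suc m′) n′ α (β ∘ punchIn j) α-inj (punchIn-injective j _ _ ∘ β-inj)
        (+-cancelˡ-< r _ _ (begin-strict
          r + (r * n′ + s * suc m′)  ≡⟨ +-assoc r (r * n′) (s * suc m′) ⟨
          r + r * n′ + s * suc m′    ≡⟨ cong (_+ s * suc m′) (*-suc r n′) ⟨
          r * suc n′ + s * suc m′    <⟨ dense ⟩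
          total (matrix α β)         ≡⟨ total-removeColumn (matrix α β) j ⟩
          ones (λ i → matrix α β i j) + total (matrix α (β ∘ punchIn j))  ≤⟨ +-monoˡ-≤ _ deg≤r ⟩
          r + total (matrix α (β ∘ punchIn j))                            ∎))
      where open ≤-Reasoning
    ... | no noRow | no noColumn =
      largeDegrees⇒contains α β α-inj β-inj
        (λ i → ≰⇒> λ deg≤s → noRow (i , deg≤s)) (λ j → ≰⇒> λ deg≤r → noColumn (j , deg≤r))

  dense⇒contains : r * n + s * m < edgeCount G → Contains (toGraph G) (toGraph T)
  dense⇒contains dense =
    dense⇒contains′ m n id id id id (subst (r * n + s * m <_) (edgeCount≡total G) dense)

-- Lower bound

-- The complete bipartite graph with parts `r` and `n`, together with `k` isolated vertices in A.
fullRows : ∀ r k {n} → Bipartite (r + k) n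
fullRows r k = replicate r ⊤ Vec.++ replicate k ⊥

edgeCount-fullRows : ∀ r k n → edgeCount (fullRows r k {n}) ≡ r * n
edgeCount-fullRows zero zero n = refl
edgeCount-fullRows zero (suc k) n = cong₂ _+_ (∣⊥∣≡0 n) (edgeCount-fullRows zero k n)
edgeCount-fullRows (suc r) k n = cong₂ _+_ (∣⊤∣≡n n) (edgeCount-fullRows r k n)

fullRows-nonisolated : ∀ r k {n} a {b : Fin n} →
  b ∈ lookup (fullRows r k) a → ∃[ i ] a ≡ i ↑ˡ k
fullRows-nonisolated zero k a b∈ =
  contradiction (subst (_ ∈_) (lookup-replicate a ⊥) b∈) ∉⊥
fullRows-nonisolated (suc r) k zero b∈ = zero , refl
fullRows-nonisolated (suc r) k (suc a) b∈ =
  let i , a≡i = fullRows-nonisolated r k a b∈ in suc i , cong suc a≡i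

onLeft : ∀ {m n} → Fin m ⊎ Fin n → Bool
onLeft (inj₁ _) = true
onLeft (inj₂ _) = false

adj⇒opposite : ∀ {m n} (G : Bipartite m n) u v → Adj G u v → onLeft u ≡ not (onLeft v)
adj⇒opposite G (inj₁ _) (inj₂ _) _ = refl
adj⇒opposite G (inj₂ _) (inj₁ _) _ = refl

module _ {r s : ℕ} (T : Bipartite (suc r) (suc s)) (tree : IsTree (toGraph T)) where
  open IsTree tree

  -- A walk to a vertex of the opposite class cannot be empty, and its first edge supplies the
  -- neighbour.
  nonisolated : ∀ u → ∃[ v ] Adj T u v
  nonisolated (inj₁ a) with connected (inj₁ a) (inj₂ zero)
  ... | u~v ◅ _ = _ , u~v
  nonisolated (inj₂ b) with connected (inj₂ b) (inj₁ zero)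
  ... | u~v ◅ _ = _ , u~v

  private
    module Sides {k n : ℕ} (φ : Fin (suc r) ⊎ Fin (suc s) → Fin (r + k) ⊎ Fin n)
      (φ-inj : Injective _≡_ _≡_ φ)
      (φ-hom : ∀ {u v} → Adj T u v → Adj (fullRows r k) (φ u) (φ v)) where

      -- Used with f = id and f = not: φ either preserves the sides or swaps them.
      sides : (f : Bool → Bool) → (∀ x → f (not x) ≡ not (f x)) →
        ∀ {u v} → Star (Adj T) u v → onLeft (φ u) ≡ f (onLeft u) → onLeft (φ v) ≡ f (onLeft v)
      sides f f-not ε eq = eq
      sides f f-not {u} (_◅_ {j = w} u~w path) eq = sides f f-not path (begin
        onLeft (φ w)        ≡⟨ adj⇒opposite (fullRows r k) (φ w) (φ u) (φ-hom (Graph.sym (toGraph T) {u} {w} u~w)) ⟩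
        not (onLeft (φ u))  ≡⟨ cong not eq ⟩
        not (f (onLeft u))  ≡⟨ f-not (onLeft u) ⟨
        f (not (onLeft u))  ≡⟨ cong f (adj⇒opposite T w u (Graph.sym (toGraph T) {u} {w} u~w)) ⟨
        f (onLeft w)        ∎)
        where open ≡-Reasoning

      -- A neighbour of `u` is mapped to a neighbour of `φ u`, so `φ u` is not isolated and must be
      -- one of the `r` full rows.
      slot : ∀ u → onLeft (φ u) ≡ true → ∃[ i ] φ u ≡ inj₁ (i ↑ˡ k)
      slot u left with φ u | φ (proj₁ (nonisolated u)) | φ-hom (proj₂ (nonisolated u))
      slot u refl | inj₁ a | inj₂ b | b∈ =
        let i , a≡i = fullRows-nonisolated r k a b∈ in i , cong inj₁ a≡i

      -- Pigeonhole on the full rows: distinct tree vertices sent to A occupy distinct slots, and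
      -- there are `r` slots.
      atMost : ∀ {l} (ι : Fin l → Fin (suc r) ⊎ Fin (suc s)) → Injective _≡_ _≡_ ι →
        (∀ i → onLeft (φ (ι i)) ≡ true) → l ≤ r
      atMost ι ι-inj left = injective⇒≤ λ {i} {j} eq → ι-inj (φ-inj (begin
        φ (ι i)                                  ≡⟨ proj₂ (slot (ι i) (left i)) ⟩
        inj₁ (proj₁ (slot (ι i) (left i)) ↑ˡ k)  ≡⟨ cong (inj₁ ∘ (_↑ˡ k)) eq ⟩
        inj₁ (proj₁ (slot (ι j) (left j)) ↑ˡ k)  ≡⟨ proj₂ (slot (ι j) (left j)) ⟨
        φ (ι j)                                  ∎))
        where open ≡-Reasoning

  fullRows-free : r ≤ s → ∀ k {n} → toGraph (fullRows r k {n}) isFreeOf toGraph T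
  fullRows-free r≤s k {n} (φ , φ-inj , φ-hom) with onLeft (φ (inj₁ zero)) in side
  ... | true = 1+n≰n (atMost inj₁ inj₁-injective
          λ a → sides id (λ _ → refl) (connected (inj₁ zero) (inj₁ a)) side)
    where open Sides φ φ-inj φ-hom
  -- The sides are swapped, so all `s + 1` vertices of S land in A. This gives `s + 1 ≤ r`, against
  -- `r ≤ s`.
  ... | false = ≤⇒≯ r≤s (atMost inj₂ inj₂-injective
          λ b → sides not (λ _ → refl) (connected (inj₁ zero) (inj₂ b)) side)
    where open Sides φ φ-inj φ-hom

-- The extremal number and its bounds

extremal : ∀ {r s} → r ≤ s → ∀ k n (T : Bipartite (suc r) (suc s)) → IsTree (toGraph T) →
  ∃[ ex ] IsEx (r + k) n (toGraph T) ex × r * n ≤ ex × ex ≤ r * n + s * (r + k)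
extremal {r} {s} r≤s k n T tree =
  -- `K` is both the witness that starts the search and the source of the lower bound; `bounded` is
  -- both the ceiling from which the search descends and the upper bound.
  let G , G-free , G-max = searchMax (searchVec anySubset? (r + k))
        (λ G → ¬? (contains? (toGraph G) (toGraph T))) edgeCount (K , K-free) _ bounded
  in edgeCount G , ((G , G-free , refl) , G-max) ,
     subst (_≤ edgeCount G) (edgeCount-fullRows r k n) (G-max K K-free) , bounded G G-free
  where
  K : Bipartite (r + k) n
  K = fullRows r k

  K-free : toGraph K isFreeOf toGraph T
  K-free = fullRows-free T tree r≤s k

  bounded : ∀ G → toGraph G isFreeOf toGraph T → edgeCount G ≤ r * n + s * (r + k)
  bounded G free = ≮⇒≥ (free ∘ dense⇒contains G T tree)

corollary1p3 : (r s : ℕ) → 2 ≤ r → r ≤ s →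
    Σ[ C ∈ ℕ ] ((m : ℕ) → r ≤ m →
    Σ[ N ∈ ℕ ] ((n : ℕ) → m ≤ n → N ≤ n →
    (T : Bipartite r s) → IsTree (toGraph T) →
    Σ[ ex ∈ ℕ ] (IsEx m n (toGraph T) ex
    × (r ∸ 1) * n ≤ ex
    × ex ≤ (r ∸ 1) * n + C * m)))
corollary1p3 (suc r) (suc s) _ (s≤s r≤s) = s , λ m 1+r≤m → 0 , λ n _ _ T tree →
  -- With `r` now one less than the smaller class, `m` is split into `r` full rows and `k` empty
  -- ones to fit `fullRows`.
  let k , r+k≡m = m≤n⇒∃[o]m+o≡n (<⇒≤ 1+r≤m)
  in subst (λ m → ∃[ ex ] IsEx m n (toGraph T) ex × r * n ≤ ex × ex ≤ r * n + s * m)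
       r+k≡m (extremal r≤s k n T tree)
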